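{- Let $G$ be a graph with compact canonical decomposition $$G = (G_k, A_k, B_k) \circ (G_{k-1}, A_{k-1}, B_{k-1}) \circ \cdots \circ (G_1, A_1, B_1) \circ G_0.$$ Then a labeling $\phi$ of $V(G)$ is a distinguishing labeling of $G$ if and only if, for every $i = 0, 1, \dots, k$, the restriction of $\phi$ to $V(G_i)$ is a distinguishing labeling of $G_i$. Furthermore, $D(G) = \max\{D(G_i) : i = 0, \dots, k\}$.
   Context: All graphs are finite, simple and undirected. A $c$-labeling of $G$ is a map $\phi: V(G)\to\{1,\dots,c\}$. It is distinguishing if for every non-trivial automorphism $\pi$ of $G$ there is a vertex $v$ with $\phi(v)\neq\phi(\pi(v))$. The distinguishing number $D(G)$ is the smallest $c$ such that $G$ has a distinguishing $c$-labeling. A graph is split if its vertex set can be partitioned as $A\cup B$ with $A$ inducing a complete graph and $B$ a stable set (one of $A,B$ may be empty); $(A,B)$ is a $KS$-partition, and $(G,A,B)$ denotes a split graph $G$ with a fixed $KS$-partition $(A,B)$. If $V(G)\cap V(H)=\emptyset$, the composition $(G,A,B)\circ H$ is the graph with vertex set $V(G)\cup V(H)$ and edge set $E(G)\cup E(H)\cup\{uv: u\in A, v\in V(H)\}$. If $H$ is split with $KS$-partition $(C,D)$, then $(G,A,B)\circ(H,C,D)$ is the composition graph with $KS$-partition $(A\cup C,B\cup D)$; the operation is associative. A graph is decomposable if it equals $(G,A,B)\circ H$ with $G$ and $H$ each having at least one vertex; otherwise it is indecomposable. Canonical decomposition (Tyshkevich): every graph $G$ can be written as $(G_r,A_r,B_r)\circ\cdots\circ(G_1,A_1,B_1)\circ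 G_0$ with every $G_i$ indecomposable, and this is unique up to isomorphism (isomorphisms of triples $(G_i,A_i,B_i)$ respect the $KS$-partitions). A component is trivial if it has exactly one vertex. A trivial component $G_i$ with $i\ge 1$ has type $K_1$ if its vertex is in $A_i$ and type $S_1$ if its vertex is in $B_i$. If $G_0$ and $G_1$ are both trivial, $G_0$ is given the type of $G_1$; if $G_0$ is trivial but $G_1$ is non-trivial or does not exist, $G_0$ is given no type and is left alone. Compact canonical decomposition: obtained from the canonical decomposition by maximally combining consecutive trivial components of the same type: a maximal run of $m$ consecutive trivial components of type $K_1$ is replaced by the complete graph on those $m$ vertices with $KS$-partition (all vertices, $\emptyset$), and a maximal run of $m$ consecutive trivial components of type $S_1$ is replaced by the edgeless graph on those $m$ vertices with $KS$-partition ($\emptyset$, all vertices). (If the run includes the last component $G_0$, the result is the new last component.) Components are re-indexed from $k$ down to $0$. -}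

module Defs where

open import Data.Bool using (Bool; true; false; not)
import Data.Bool.Properties as Bool
open import Data.Fin using (Fin; zero; suc; finToFun; funToFin)
import Data.Fin.Properties as Fin
open import Data.List using (List; []; _∷_; foldr; last; length; map; tabulate)
open import Data.List.Extrema.Nat using (max)
open import Data.Maybe using (Maybe; just; nothing; _>>=_)
open import Data.Nat using (ℕ; zero; suc; _+_; _≤_; _<_; z≤n; s≤s)
import Data.Nat.Properties as ℕ
open import Data.Product using (Σ; ∃; _×_; _,_; proj₁; proj₂)
open import Data.Sum using (_⊎_; inj₁; inj₂)
open import Data.Sum.Function.Propositional using (_⊎-↔_)
open import Function.Bundles using (_↔_; Inverse; mk↔ₛ′)
open import Function.Construct.Composition using (_↔-∘_)
open import Function.Construct.Identity using (↔-id)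
open import Function.Construct.Symmetry using (↔-sym)
open import Relation.Binary.PropositionalEquality
  using (_≡_; _≢_; _≗_; refl; sym; trans; cong; cong₂; subst)
open import Relation.Nullary using (¬_; Dec; yes; no; does; contradiction)
open import Relation.Nullary.Decidable using (map′; ¬?; _×-dec_; _→-dec_; dec-true; dec-false)

record Graph : Set₁ where
  field
    V          : Set
    order      : ℕ
    enum       : V ↔ Fin order
    adj        : V → V → Bool
    adj-sym    : ∀ u v → adj u v ≡ adj v u
    adj-irrefl : ∀ v → adj v v ≡ false

open Graph public

infix 4 _≅_

record _≅_ (G H : Graph) : Set where
  field
    bij     : V G ↔ V H
    adj-bij : ∀ u v → adj H (Inverse.to bij u) (Inverse.to bij v) ≡ adj G u v

  open Inverse bij public using (to; from; strictlyInverseˡ; strictlyInverseʳ)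

open _≅_ public using (to; from)

NonEmpty : Graph → Set
NonEmpty G = 0 < order G

Trivial : Graph → Set
Trivial G = order G ≡ 1

Labeling : Graph → ℕ → Set
Labeling G c = V G → Fin c

Automorphism : Graph → Set
Automorphism G = G ≅ G

NonTrivial : ∀ {G} → Automorphism G → Set
NonTrivial π = ¬ (∀ v → to π v ≡ v)

Distinguishing : ∀ G {c} → Labeling G c → Set
Distinguishing G φ =
  (π : Automorphism G) → NonTrivial π → ∃ λ v → φ v ≢ φ (to π v)

Distinguishable : Graph → ℕ → Set
Distinguishable G c = Σ (Labeling G c) (Distinguishing G)

-- The distinguishing number is computed by a search for the least c such that
-- Distinguishable G c; the search needs decidability of that predicate.

private
  module _ {X : Set} {m} (e : X ↔ Fin m) where
    open Inverse e using () renaming (to to ⌜_⌝; from to ⌞_⌟; strictlyInverseʳ to ⌞⌜_⌝⌟)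

    ∀? : {P : X → Set} → (∀ x → Dec (P x)) → Dec (∀ x → P x)
    ∀? {P} P? = map′ (λ h x → subst P ⌞⌜ x ⌝⌟ (h ⌜ x ⌝)) (λ h i → h ⌞ i ⌟)
                     (Fin.all? (λ i → P? ⌞ i ⌟))

    ∃? : {P : X → Set} → (∀ x → Dec (P x)) → Dec (∃ P)
    ∃? {P} P? = map′ (λ (i , p) → ⌞ i ⌟ , p) (λ (x , p) → ⌜ x ⌝ , subst P (sym ⌞⌜ x ⌝⌟) p)
                     (Fin.any? (λ i → P? ⌞ i ⌟))

    infix 4 _≟ₓ_
    _≟ₓ_ : (x y : X) → Dec (x ≡ y)
    x ≟ₓ y = map′ (λ q → trans (sym ⌞⌜ x ⌝⌟) (trans (cong ⌞_⌟ q) ⌞⌜ y ⌝⌟)) (cong ⌜_⌝)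
                  (⌜ x ⌝ Fin.≟ ⌜ y ⌝)

  module _ {X Y : Set} {m n} (e : X ↔ Fin m) (e′ : Y ↔ Fin n)
           {P : (X → Y) → Set} (resp : ∀ {f g} → f ≗ g → P f → P g)
           (P? : ∀ f → Dec (P f)) where
    private
      module e = Inverse e
      module e′ = Inverse e′

      decode : Fin _ → X → Y
      decode i x = e′.from (finToFun i (e.to x))

      encode : (X → Y) → Fin _
      encode f = funToFin (λ i → e′.to (f (e.from i)))

      decode-encode : ∀ f → decode (encode f) ≗ f
      decode-encode f x =
        trans (cong e′.from (Fin.finToFun-funToFin (λ i → e′.to (f (e.from i))) (e.to x)))
       (trans (e′.strictlyInverseʳ _) (cong f (e.strictlyInverseʳ x)))

    ∀→? : Dec (∀ f → P f)
    ∀→? = map′ (λ h f → resp (decode-encode f) (h (encode f))) (λ h i → h (decode i))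
               (Fin.all? (λ i → P? (decode i)))

    ∃→? : Dec (∃ P)
    ∃→? = map′ (λ (i , p) → decode i , p)
               (λ (f , p) → encode f , resp (λ x → sym (decode-encode f x)) p)
               (Fin.any? (λ i → P? (decode i)))

  module _ (G : Graph) where
    IsAut : (f g : V G → V G) → Set
    IsAut f g = ((∀ v → f (g v) ≡ v) × (∀ v → g (f v) ≡ v))
              × (∀ u v → adj G (f u) (f v) ≡ adj G u v)

    Dist′ : ∀ {c} → Labeling G c → Set
    Dist′ φ = ∀ f g → IsAut f g → ¬ (∀ v → f v ≡ v) → ∃ λ v → φ v ≢ φ (f v)

    dist′? : ∀ {c} (φ : Labeling G c) → Dec (Dist′ φ)
    dist′? φ =
      ∀→? (enum G) (enum G) respᶠ λ f →
      ∀→? (enum G) (enum G) (respᵍ f) λ g →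
      (((∀? (enum G) λ v → f (g v) ≟ v) ×-dec (∀? (enum G) λ v → g (f v) ≟ v))
        ×-dec (∀? (enum G) λ u → ∀? (enum G) λ v → adj G (f u) (f v) Bool.≟ adj G u v))
      →-dec (¬? (∀? (enum G) λ v → f v ≟ v)
      →-dec ∃? (enum G) λ v → ¬? (φ v Fin.≟ φ (f v)))
      where
      _≟_ : (x y : V G) → Dec (x ≡ y)
      _≟_ = _≟ₓ_ (enum G)

      respᵍ : ∀ f {g g′} → g ≗ g′ →
              (IsAut f g → ¬ (∀ v → f v ≡ v) → ∃ λ v → φ v ≢ φ (f v)) →
              (IsAut f g′ → ¬ (∀ v → f v ≡ v) → ∃ λ v → φ v ≢ φ (f v))
      respᵍ f q h ((a , b) , c) =
        h (((λ v → trans (cong f (q v)) (a v)) , (λ v → trans (q (f v)) (b v))) , c)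

      respᶠ : ∀ {f f′} → f ≗ f′ →
              (∀ g → IsAut f g → ¬ (∀ v → f v ≡ v) → ∃ λ v → φ v ≢ φ (f v)) →
              (∀ g → IsAut f′ g → ¬ (∀ v → f′ v ≡ v) → ∃ λ v → φ v ≢ φ (f′ v))
      respᶠ q h g ((a , b) , c) nt =
        let v , φ≢ = h g
              (((λ v → trans (q (g v)) (a v)) , (λ v → trans (cong g (q v)) (b v)))
              , (λ u v → trans (cong₂ (adj G) (q u) (q v)) (c u v)))
              (λ triv → nt (λ v → trans (sym (q v)) (triv v)))
        in v , λ eq → φ≢ (trans eq (cong φ (sym (q v))))

    distinguishing? : ∀ {c} (φ : Labeling G c) → Dec (Distinguishing G φ)
    distinguishing? φ = map′
      (λ h π → h (to π) (from π)
        ((_≅_.strictlyInverseˡ π , _≅_.strictlyInverseʳ π) , _≅_.adj-bij π))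
      (λ h f g ((a , b) , c) → h (record { bij = mk↔ₛ′ f g a b ; adj-bij = c }))
      (dist′? φ)

    distinguishable? : ∀ c → Dec (Distinguishable G c)
    distinguishable? c = ∃→? (enum G) (↔-id (Fin c))
      (λ q h π nt → let v , φ≢ = h π nt
                    in v , λ eq → φ≢ (trans (q v) (trans eq (sym (q _)))))
      distinguishing?

    distinguishable-order : Distinguishable G (order G)
    distinguishable-order = Inverse.to (enum G) , λ π nt → find π (∃? (enum G) (moved? π)) nt
      where
      Moved : Automorphism G → V G → Set
      Moved π v = Inverse.to (enum G) v ≢ Inverse.to (enum G) (to π v)

      moved? : ∀ π v → Dec (Moved π v)
      moved? π v = ¬? (Inverse.to (enum G) v Fin.≟ Inverse.to (enum G) (to π v))

      find : ∀ π → Dec (∃ (Moved π)) → NonTrivial π → ∃ (Moved π)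
      find π (yes m) _  = m
      find π (no ¬m) nt = contradiction fixed nt
        where
        fixed : ∀ v → to π v ≡ v
        fixed v with _≟ₓ_ (enum G) (to π v) v
        ... | yes q = q
        ... | no ¬q = contradiction (v , λ q → ¬q (sym (inj q))) ¬m
          where
          inj : ∀ {x y} → Inverse.to (enum G) x ≡ Inverse.to (enum G) y → x ≡ y
          inj q = trans (sym (Inverse.strictlyInverseʳ (enum G) _))
                 (trans (cong (Inverse.from (enum G)) q) (Inverse.strictlyInverseʳ (enum G) _))

IsLeast : (ℕ → Set) → ℕ → Set
IsLeast P c = P c × (∀ c′ → P c′ → c ≤ c′)

least : ∀ {P : ℕ → Set} → (∀ c → Dec (P c)) → ∀ n → P n → ∃ (IsLeast P)
least P? zero    p = zero , p , λ _ _ → z≤n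
least P? (suc n) p with P? zero
... | yes p₀ = zero , p₀ , λ _ _ → z≤n
... | no ¬p₀ with c , pc , min ← least (λ c → P? (suc c)) n p =
  suc c , pc , λ { zero q → contradiction q ¬p₀ ; (suc c′) q → s≤s (min c′ q) }

leastDistinguishable : ∀ G → ∃ (IsLeast (Distinguishable G))
leastDistinguishable G = least (distinguishable? G) (order G) (distinguishable-order G)

D : Graph → ℕ
D G = proj₁ (leastDistinguishable G)

D-isLeast : ∀ G → IsLeast (Distinguishable G) (D G)
D-isLeast G = proj₂ (leastDistinguishable G)

data Part : Set where
  A B : Part

_≟ᴾ_ : (p q : Part) → Dec (p ≡ q)
A ≟ᴾ A = yes refl
A ≟ᴾ B = no λ ()
B ≟ᴾ A = no λ ()
B ≟ᴾ B = yes refl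

record SplitGraph : Set₁ where
  field
    graph  : Graph
    part   : V graph → Part
    clique : ∀ u v → part u ≡ A → part v ≡ A → u ≢ v → adj graph u v ≡ true
    stable : ∀ u v → part u ≡ B → part v ≡ B → adj graph u v ≡ false

open SplitGraph public

inA : Part → Bool
inA A = true
inA B = false

infixr 9 _∘_

_∘_ : SplitGraph → Graph → Graph
S ∘ H = record
  { V          = V (graph S) ⊎ V H
  ; order      = order (graph S) + order H
  ; enum       = ↔-sym Fin.+↔⊎ ↔-∘ (enum (graph S) ⊎-↔ enum H)
  ; adj        = λ { (inj₁ u) (inj₁ v) → adj (graph S) u v
                   ; (inj₁ u) (inj₂ _) → inA (part S u)
                   ; (inj₂ _) (inj₁ v) → inA (part S v)
                   ; (inj₂ u) (inj₂ v) → adj H u v }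
  ; adj-sym    = λ { (inj₁ u) (inj₁ v) → adj-sym (graph S) u v
                   ; (inj₁ _) (inj₂ _) → refl
                   ; (inj₂ _) (inj₁ _) → refl
                   ; (inj₂ u) (inj₂ v) → adj-sym H u v }
  ; adj-irrefl = λ { (inj₁ v) → adj-irrefl (graph S) v
                   ; (inj₂ v) → adj-irrefl H v }
  }

Decomposable : Graph → Set₁
Decomposable G =
  Σ SplitGraph λ S → Σ Graph λ H → NonEmpty (graph S) × NonEmpty H × G ≅ S ∘ H

Indecomposable : Graph → Set₁
Indecomposable G = ¬ Decomposable G

-- A pair (Gᵣ , … , G₁ ∷ []) , G₀; the list is ordered from the outermost
-- component Gᵣ down to G₁.  As composition is associative, the composed graph
-- may be taken bracketed to the right.

record Decomposition : Set₁ where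
  constructor _▹_
  field
    outer : List SplitGraph
    core  : Graph

open Decomposition public

⟦_⟧ : Decomposition → Graph
⟦ Ss ▹ H ⟧ = foldr _∘_ H Ss

-- Positions are counted from the outside: the last one is the core G₀.

Index : Decomposition → Set
Index d = Fin (suc (length (outer d)))

component : (d : Decomposition) → Index d → Graph
component ([]       ▹ H) zero    = H
component ((S ∷ Ss) ▹ H) zero    = graph S
component ((S ∷ Ss) ▹ H) (suc i) = component (Ss ▹ H) i

include : (d : Decomposition) (i : Index d) → V (component d i) → V ⟦ d ⟧
include ([]       ▹ H) zero    v = v
include ((S ∷ Ss) ▹ H) zero    v = inj₁ v
include ((S ∷ Ss) ▹ H) (suc i) v = inj₂ (include (Ss ▹ H) i v)

-- Components have at least one vertex (otherwise the decomposition would not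
-- be unique).

IsCanonical : Decomposition → Set₁
IsCanonical d = ∀ i → NonEmpty (component d i) × Indecomposable (component d i)

-- The type of a trivial component is the part containing its vertex:
-- A stands for K₁ and B for S₁.

type : SplitGraph → Maybe Part
type S with order (graph S) ℕ.≟ 1
... | yes q = just (part S (Inverse.from (enum (graph S)) (subst Fin (sym q) zero)))
... | no  _ = nothing

-- G₀ inherits a type from G₁ when both are trivial, and has none otherwise.

coreType : Decomposition → Maybe Part
coreType (Ss ▹ H) with order H ℕ.≟ 1
... | yes _ = last Ss >>= type
... | no  _ = nothing

-- Complete (t = A) or edgeless (t = B) graph on m vertices, all in part t.

uniform : Part → ℕ → SplitGraph
uniform t m = record
  { graph  = record
    { V          = Fin m
    ; order      = m
    ; enum       = ↔-id (Fin m)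
    ; adj        = edge t
    ; adj-sym    = edge-sym t
    ; adj-irrefl = edge-irrefl t
    }
  ; part   = λ _ → t
  ; clique = λ { u v refl refl u≢v → cong not (dec-false (u Fin.≟ v) u≢v) }
  ; stable = λ { u v refl refl → refl }
  }
  where
  edge : Part → Fin m → Fin m → Bool
  edge A u v = not (does (u Fin.≟ v))
  edge B u v = false

  edge-irrefl : ∀ t v → edge t v v ≡ false
  edge-irrefl A v = cong not (dec-true (v Fin.≟ v) refl)
  edge-irrefl B v = refl

  edge-sym : ∀ t u v → edge t u v ≡ edge t v u
  edge-sym B u v = refl
  edge-sym A u v with u Fin.≟ v
  ... | yes refl = sym (edge-irrefl A u)
  ... | no  u≢v  = sym (cong not (dec-false (v Fin.≟ u) (λ q → u≢v (sym q))))

-- run t m is a run of m consecutive trivial components of type t; keep holds an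
-- untyped component.

data Block (X : Set₁) : Set₁ where
  run  : Part → ℕ → Block X
  keep : X → Block X

Blocks : Set₁
Blocks = List (Block SplitGraph) × Block Graph

coreBlock : Maybe Part → Graph → Block Graph
coreBlock (just t) H = run t 1
coreBlock nothing  H = keep H

-- bs , b lists the blocks from the outside inwards, b being the innermost; the
-- head of bs (or b, if bs is empty) is the block that may have to be extended.

addTrivial : Part → Blocks → Blocks
addTrivial t (run t′ m ∷ bs , b) with t ≟ᴾ t′
... | yes _ = run t (suc m) ∷ bs , b
... | no  _ = run t 1 ∷ run t′ m ∷ bs , b
addTrivial t ([] , run t′ m) with t ≟ᴾ t′
... | yes _ = [] , run t (suc m)
... | no  _ = run t 1 ∷ [] , run t′ m
addTrivial t (bs , b) = run t 1 ∷ bs , b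

addComponent : SplitGraph → Blocks → Blocks
addComponent S (bs , b) with type S
... | just t  = addTrivial t (bs , b)
... | nothing = keep S ∷ bs , b

blocks : Decomposition → Blocks
blocks d = foldr addComponent ([] , coreBlock (coreType d) (core d)) (outer d)

realiseSplit : Block SplitGraph → SplitGraph
realiseSplit (run t m) = uniform t m
realiseSplit (keep S)  = S

realiseCore : Block Graph → Graph
realiseCore (run t m) = graph (uniform t m)
realiseCore (keep H)  = H

compact : Decomposition → Decomposition
compact d = let bs , b = blocks d in map realiseSplit bs ▹ realiseCore b

-- "G equals the composition" is rendered by an arbitrary isomorphism, through
-- which the vertex sets of the components become subsets of V G.

record CompactCanonicalDecomposition (G : Graph) : Set₁ where
  field
    canonical     : Decomposition
    isCanonical   : IsCanonical canonical
    canonical-iso : G ≅ ⟦ canonical ⟧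
    compact-iso   : G ≅ ⟦ compact canonical ⟧

  compacted : Decomposition
  compacted = compact canonical

  embed : (i : Index compacted) → V (component compacted i) → V G
  embed i v = from compact-iso (include compacted i v)

  restrict : ∀ {c} → Labeling G c → (i : Index compacted) → Labeling (component compacted i) c
  restrict φ i v = φ (embed i v)

maximum : ∀ {n} → (Fin n → ℕ) → ℕ
maximum f = max 0 (tabulate f)

{-# OPTIONS --safe #-}

-- A labeling is distinguishing iff only the trivial automorphism preserves it, so
-- it is enough that the automorphisms of S ∘ H are exactly the pairs of automorphisms
-- of S and H whenever S is the outermost block of a compact decomposition.  If S is
-- indecomposable with at least two vertices, then S and its image under an
-- automorphism are two prefixes of S ∘ H, and so is their intersection; it cannot cut
-- S properly, and if it is empty then S is a clique or a stable set, which is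
-- decomposable.  If S is a run of type K₁ (S₁), maximality of the run makes its
-- vertices exactly the universal (isolated) ones.  The same intersection argument,
-- applied to the KS-partition of S and its image under an automorphism of S, shows
-- that automorphisms of S preserve the KS-partition and hence extend to S ∘ H.

module Submission where

open import Defs
open import Axiom.UniquenessOfIdentityProofs using (module Decidable⇒UIP)
open import Data.Bool using (Bool; true; false; not)
import Data.Bool.Properties as Bool
open import Data.Empty using (⊥)
open import Data.Fin using (Fin; zero; suc; inject≤)
import Data.Fin.Properties as Fin
open import Data.List using ([]; _∷_; foldr; map)
open import Data.List.Extrema.Nat using (max≤v⁺; xs≤max)
import Data.List.Relation.Unary.All.Properties as All
open import Data.Maybe using (Maybe; just; nothing; is-just; is-nothing; fromMaybe)
open import Data.Maybe.Properties using (just-injective; ≡-dec)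
open import Data.Nat using (ℕ; zero; suc; _≤_; z≤n; s≤s)
import Data.Nat.Properties as ℕ
open import Data.Product using (∃; _×_; _,_; proj₁; proj₂; map₂)
open import Data.Sum using (_⊎_; inj₁; inj₂; [_,_]; [_,_]′)
open import Data.Sum.Function.Propositional using (_⊎-↔_)
open import Data.Sum.Properties using (inj₁-injective; inj₂-injective)
open import Data.Unit using (⊤; tt)
open import Function.Base using (id; case_of_)
open import Function.Bundles using (_↔_; _⇔_; mk↔ₛ′; mk⇔; Inverse; Equivalence)
open import Function.Construct.Composition using (_↔-∘_; _⇔-∘_)
open import Function.Construct.Identity using (↔-id)
open import Function.Construct.Symmetry using (↔-sym)
open import Function.Properties.Inverse using (↔⇒↣)
open import Relation.Binary.Definitions using (DecidableEquality)
open import Relation.Binary.PropositionalEquality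
  using (_≡_; _≢_; _≗_; refl; sym; trans; cong; cong₂; subst)
open import Relation.Nullary using (¬_; yes; no; contradiction)
open import Relation.Nullary.Decidable using (decidable-stable)

-- Parts and graph isomorphisms

opposite : Part → Part
opposite A = B
opposite B = A

opposite-involutive : ∀ t → opposite (opposite t) ≡ t
opposite-involutive A = refl
opposite-involutive B = refl

≢opposite : ∀ t → t ≢ opposite t
≢opposite A ()
≢opposite B ()

≢opposite⇒≡ : ∀ {p} t → p ≢ opposite t → p ≡ t
≢opposite⇒≡ {A} A _ = refl
≢opposite⇒≡ {A} B n = contradiction refl n
≢opposite⇒≡ {B} A n = contradiction refl n
≢opposite⇒≡ {B} B _ = refl

inA-injective : ∀ {s t} → inA s ≡ inA t → s ≡ t
inA-injective {A} {A} _ = refl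
inA-injective {B} {B} _ = refl

inA-surjective : ∀ b → ∃ λ t → b ≡ inA t
inA-surjective true  = A , refl
inA-surjective false = B , refl

_≟ᴹ_ : DecidableEquality (Maybe Part)
_≟ᴹ_ = ≡-dec _≟ᴾ_

≟-vertex : ∀ G → DecidableEquality (V G)
≟-vertex G = Fin.inj⇒≟ (↔⇒↣ (enum G))

≅-sym : ∀ {G H} → G ≅ H → H ≅ G
≅-sym {G} {H} f = record
  { bij     = ↔-sym (_≅_.bij f)
  ; adj-bij = λ u v → trans (sym (_≅_.adj-bij f (from f u) (from f v)))
                            (cong₂ (adj H) (_≅_.strictlyInverseˡ f u) (_≅_.strictlyInverseˡ f v))
  }

≅-trans : ∀ {G H K} → G ≅ H → H ≅ K → G ≅ K
≅-trans f g = record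
  { bij     = _≅_.bij g ↔-∘ _≅_.bij f
  ; adj-bij = λ u v → trans (_≅_.adj-bij g (to f u) (to f v)) (_≅_.adj-bij f u v)
  }

≅-refl : ∀ {G} → G ≅ G
≅-refl = record { bij = ↔-id _ ; adj-bij = λ _ _ → refl }

to-injective : ∀ {G H} (f : G ≅ H) {u v} → to f u ≡ to f v → u ≡ v
to-injective f {u} {v} eq =
  trans (sym (_≅_.strictlyInverseʳ f u)) (trans (cong (from f) eq) (_≅_.strictlyInverseʳ f v))

-- Rigid labelings

Rigid : ∀ G {c} → Labeling G c → Set
Rigid G φ = (π : Automorphism G) → (∀ v → φ v ≡ φ (to π v)) → ∀ v → to π v ≡ v

-- Contraposition is constructive here: equality of vertices is decidable, and a vertex that changes
-- its label is found by search through the enumeration.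
distinguishing⇔rigid : ∀ G {c} (φ : Labeling G c) → Distinguishing G φ ⇔ Rigid G φ
distinguishing⇔rigid G φ = mk⇔ ⇒ ⇐
  where
  module e = Inverse (enum G)

  ⇒ : Distinguishing G φ → Rigid G φ
  ⇒ dist π pres v = decidable-stable (≟-vertex G _ _) λ moved →
    let w , φ≢ = dist π (λ triv → moved (triv v)) in φ≢ (pres w)

  ⇐ : Rigid G φ → Distinguishing G φ
  ⇐ rigid π nonTrivial =
    let i , φ≢ = Fin.¬∀⟶∃¬ _ (λ i → φ (e.from i) ≡ φ (to π (e.from i))) (λ _ → _ Fin.≟ _)
                   λ pres → nonTrivial (rigid π λ v →
                     subst (λ w → φ w ≡ φ (to π w)) (e.strictlyInverseʳ v) (pres (e.to v)))
    in e.from i , φ≢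

rigid-cong : ∀ G {c} {φ ψ : Labeling G c} → φ ≗ ψ → Rigid G φ → Rigid G ψ
rigid-cong G φ≗ψ rigid π pres =
  rigid π λ v → trans (φ≗ψ v) (trans (pres v) (sym (φ≗ψ _)))

rigid-transport : ∀ {G H} (f : G ≅ H) {c} (φ : Labeling G c) →
                  Rigid G φ → Rigid H (λ v → φ (from f v))
rigid-transport f φ rigid π pres v =
  to-injective (≅-sym f)
    (trans (cong (λ w → from f (to π w)) (sym (_≅_.strictlyInverseˡ f v)))
           (rigid (≅-trans f (≅-trans π (≅-sym f)))
                  (λ u → trans (cong φ (sym (_≅_.strictlyInverseʳ f u))) (pres (to f u)))
                  (from f v)))

rigid-≅ : ∀ {G H} (f : G ≅ H) {c} (φ : Labeling G c) →
          Rigid G φ ⇔ Rigid H (λ v → φ (from f v))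
rigid-≅ {G} f φ = mk⇔ (rigid-transport f φ) λ rigid →
  rigid-cong G (λ v → cong φ (_≅_.strictlyInverseʳ f v))
    (rigid-transport (≅-sym f) (λ v → φ (from f v)) rigid)

-- Automorphisms of a composition

-- Quantifying over all automorphisms covers inverses as well, so vertices of `H` also stay in `H`.
Splits : SplitGraph → Graph → Set
Splits S H = (π : Automorphism (S ∘ H)) → ∀ u → ∃ λ u′ → to π (inj₁ u) ≡ inj₁ u′

-- Adjacency across a composition depends on the part alone, so this is what lets `σ` extend to the
-- composition.
PartRigid : SplitGraph → Set
PartRigid S = (σ : Automorphism (graph S)) → ∀ u → part S (to σ u) ≡ part S u

Tame : Decomposition → Set
Tame ([]       ▹ H) = ⊤
Tame ((S ∷ Ss) ▹ H) = Splits S ⟦ Ss ▹ H ⟧ × PartRigid S × Tame (Ss ▹ H)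

∘-automorphism : ∀ S H → PartRigid S → Automorphism (graph S) → Automorphism H →
                 Automorphism (S ∘ H)
∘-automorphism S H rigid σ τ = record
  { bij     = _≅_.bij σ ⊎-↔ _≅_.bij τ
  ; adj-bij = λ { (inj₁ u) (inj₁ v) → _≅_.adj-bij σ u v
                ; (inj₁ u) (inj₂ _) → cong inA (rigid σ u)
                ; (inj₂ _) (inj₁ v) → cong inA (rigid σ v)
                ; (inj₂ u) (inj₂ v) → _≅_.adj-bij τ u v }
  }

module Restriction {S H} (splits : Splits S H) where

  splits₂ : (π : Automorphism (S ∘ H)) → ∀ h → ∃ λ h′ → to π (inj₂ h) ≡ inj₂ h′
  splits₂ π h with to π (inj₂ h) in eq
  ... | inj₂ h′ = h′ , refl
  -- Otherwise the inverse of `π` would send a vertex of `S` into `H`.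
  ... | inj₁ u
      with () ← trans (sym (proj₂ (splits (≅-sym π) u)))
                      (trans (cong (from π) (sym eq)) (_≅_.strictlyInverseʳ π (inj₂ h)))

  restrict₁ : Automorphism (S ∘ H) → Automorphism (graph S)
  restrict₁ π = record
    { bij     = mk↔ₛ′ (λ u → proj₁ (splits π u)) (λ u → proj₁ (splits (≅-sym π) u))
                      (λ u → inverse (≅-sym π) π u (_≅_.strictlyInverseˡ π _))
                      (λ u → inverse π (≅-sym π) u (_≅_.strictlyInverseʳ π _))
    ; adj-bij = λ u v → trans (cong₂ (adj (S ∘ H)) (sym (proj₂ (splits π u))) (sym (proj₂ (splits π v))))
                              (_≅_.adj-bij π (inj₁ u) (inj₁ v))
    }
    where
    inverse : (π ρ : Automorphism (S ∘ H)) → ∀ u → to ρ (to π (inj₁ u)) ≡ inj₁ u →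
              proj₁ (splits ρ (proj₁ (splits π u))) ≡ u
    inverse π ρ u eq = inj₁-injective
      (trans (sym (proj₂ (splits ρ _))) (trans (cong (to ρ) (sym (proj₂ (splits π u)))) eq))

  restrict₂ : Automorphism (S ∘ H) → Automorphism H
  restrict₂ π = record
    { bij     = mk↔ₛ′ (λ h → proj₁ (splits₂ π h)) (λ h → proj₁ (splits₂ (≅-sym π) h))
                      (λ h → inverse (≅-sym π) π h (_≅_.strictlyInverseˡ π _))
                      (λ h → inverse π (≅-sym π) h (_≅_.strictlyInverseʳ π _))
    ; adj-bij = λ u v → trans (cong₂ (adj (S ∘ H)) (sym (proj₂ (splits₂ π u))) (sym (proj₂ (splits₂ π v))))
                              (_≅_.adj-bij π (inj₂ u) (inj₂ v))
    }
    where
    inverse : (π ρ : Automorphism (S ∘ H)) → ∀ h → to ρ (to π (inj₂ h)) ≡ inj₂ h →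
              proj₁ (splits₂ ρ (proj₁ (splits₂ π h))) ≡ h
    inverse π ρ h eq = inj₂-injective
      (trans (sym (proj₂ (splits₂ ρ _))) (trans (cong (to ρ) (sym (proj₂ (splits₂ π h)))) eq))

-- Forwards, an automorphism of one factor is extended by the identity on the other; backwards, an
-- automorphism of the composition is restricted to each factor.
rigid-∘ : ∀ S H → Splits S H → PartRigid S → ∀ {c} (φ : Labeling (S ∘ H) c) →
          Rigid (S ∘ H) φ ⇔ (Rigid (graph S) (λ u → φ (inj₁ u)) × Rigid H (λ h → φ (inj₂ h)))
rigid-∘ S H splits partRigid φ = mk⇔
  (λ rigid →
      (λ σ pres u → inj₁-injective
        (rigid (∘-automorphism S H partRigid σ ≅-refl) [ pres , (λ _ → refl) ] (inj₁ u)))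
    , (λ τ pres h → inj₂-injective
        (rigid (∘-automorphism S H partRigid ≅-refl τ) [ (λ _ → refl) , pres ] (inj₂ h))))
  (λ (rigid₁ , rigid₂) π pres →
    [ (λ u → trans (proj₂ (splits π u))
               (cong inj₁ (rigid₁ (restrict₁ π)
                 (λ u → trans (pres (inj₁ u)) (cong φ (proj₂ (splits π u)))) u)))
    , (λ h → trans (proj₂ (splits₂ π h))
               (cong inj₂ (rigid₂ (restrict₂ π)
                 (λ h → trans (pres (inj₂ h)) (cong φ (proj₂ (splits₂ π h)))) h))) ])
  where
  open Restriction {S} {H} splits

rigid-components : ∀ Ss H → let d = Ss ▹ H in Tame d → ∀ {c} (φ : Labeling ⟦ d ⟧ c) →
                   Rigid ⟦ d ⟧ φ ⇔ (∀ i → Rigid (component d i) (λ v → φ (include d i v)))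
rigid-components [] H _ φ = mk⇔ (λ { rigid zero → rigid }) (λ rigid → rigid zero)
rigid-components (S ∷ Ss) H (splits , partRigid , tame) φ = mk⇔
  (λ { rigid zero    → proj₁ (first.to rigid)
     ; rigid (suc i) → rest.to (proj₂ (first.to rigid)) i })
  (λ rigid → first.from (rigid zero , rest.from λ i → rigid (suc i)))
  where
  module first = Equivalence (rigid-∘ S ⟦ Ss ▹ H ⟧ splits partRigid φ)
  module rest  = Equivalence (rigid-components Ss H tame (λ v → φ (inj₂ v)))

-- Peelings

-- c v = just t puts v into part t of an outer split graph, c v = nothing into
-- the remaining graph; the composition of the two is then the whole graph.
Peels : ∀ G → (V G → Maybe Part) → Set
Peels G c = ∀ {t} u v → c u ≡ just t → c v ≢ just (opposite t) → u ≢ v → adj G u v ≡ inA t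

-- With a Boolean predicate, membership proofs are unique, so elements are equal once their first
-- components are.
Satisfying : {X : Set} → (X → Bool) → Set
Satisfying p = ∃ λ x → p x ≡ true

Satisfying-≡ : {X : Set} {p : X → Bool} {x y : Satisfying p} → proj₁ x ≡ proj₁ y → x ≡ y
Satisfying-≡ {x = x , q} {y = .x , q′} refl = cong (x ,_) (Decidable⇒UIP.≡-irrelevant Bool._≟_ q q′)

enumerate-Fin : ∀ {m} (p : Fin m → Bool) → ∃ λ k → Satisfying p ↔ Fin k
enumerate-Fin {zero}  p = 0 , mk↔ₛ′ (λ ()) (λ ()) (λ ()) (λ ())
enumerate-Fin {suc m} p with p zero in eq | enumerate-Fin (λ i → p (suc i))
... | true | k , e = suc k , mk↔ₛ′
  (λ { (zero , _) → zero ; (suc i , q) → suc (Inverse.to e (i , q)) })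
  (λ { zero → zero , eq ; (suc j) → let i , q = Inverse.from e j in suc i , q })
  (λ { zero → refl ; (suc j) → cong suc (Inverse.strictlyInverseˡ e j) })
  (λ { (zero , _) → Satisfying-≡ refl
     ; (suc i , q) → Satisfying-≡ (cong (λ x → suc (proj₁ x)) (Inverse.strictlyInverseʳ e (i , q))) })
... | false | k , e = k , mk↔ₛ′
  (λ { (zero , q) → contradiction (trans (sym eq) q) λ () ; (suc i , q) → Inverse.to e (i , q) })
  (λ j → let i , q = Inverse.from e j in suc i , q)
  (Inverse.strictlyInverseˡ e)
  (λ { (zero , q) → contradiction (trans (sym eq) q) λ ()
     ; (suc i , q) → Satisfying-≡ (cong (λ x → suc (proj₁ x)) (Inverse.strictlyInverseʳ e (i , q))) })

enumerate : {X : Set} {m : ℕ} → X ↔ Fin m → (p : X → Bool) → ∃ λ k → Satisfying p ↔ Fin k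
enumerate e p = map₂ (_↔-∘ transfer) (enumerate-Fin (λ i → p (e.from i)))
  where
  module e = Inverse e

  transfer : Satisfying p ↔ Satisfying (λ i → p (e.from i))
  transfer = mk↔ₛ′
    (λ (x , q) → e.to x , trans (cong p (e.strictlyInverseʳ x)) q)
    (λ (i , q) → e.from i , q)
    (λ (i , _) → Satisfying-≡ (e.strictlyInverseˡ i))
    (λ (x , _) → Satisfying-≡ (e.strictlyInverseʳ x))

induced : (G : Graph) → (V G → Bool) → Graph
induced G p = record
  { V          = Satisfying p
  ; order      = proj₁ (enumerate (enum G) p)
  ; enum       = proj₂ (enumerate (enum G) p)
  ; adj        = λ (u , _) (v , _) → adj G u v
  ; adj-sym    = λ (u , _) (v , _) → adj-sym G u v
  ; adj-irrefl = λ (v , _) → adj-irrefl G v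
  }

nonEmpty : ∀ G → V G → NonEmpty G
nonEmpty G v with order G | Inverse.to (enum G) v
... | suc _ | _ = s≤s z≤n

is-just⇒≡ : ∀ {x : Maybe Part} → is-just x ≡ true → x ≡ just (fromMaybe A x)
is-just⇒≡ {just _} _ = refl

is-nothing⇒≡ : ∀ {x : Maybe Part} → is-nothing x ≡ true → x ≡ nothing
is-nothing⇒≡ {nothing} _ = refl

just≢opposite : ∀ {x} t → x ≡ just t → x ≢ just (opposite t)
just≢opposite t eq eq′ = ≢opposite t (just-injective (trans (sym eq) eq′))

nothing≢just : ∀ {x : Maybe Part} {t} → x ≡ nothing → x ≢ just t
nothing≢just refl ()

-- The vertices with a part form the outer split graph and the others the inner graph; `u` and `v`
-- show that neither is empty.
peels⇒decomposable : ∀ G {c} → Peels G c → ∀ {u v t} → c u ≡ just t → c v ≡ nothing →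
                     Decomposable G
peels⇒decomposable G {c} peels {u} {v} u-in v-out =
  S , H , nonEmpty (graph S) (u , cong is-just u-in) , nonEmpty H (v , cong is-nothing v-out) , record
    { bij     = mk↔ₛ′ split join
                      (λ { (inj₁ (x , q)) → split-in x q ; (inj₂ (x , q)) → split-out x q })
                      join-split
    ; adj-bij = λ x y → trans (adj-join (split x) (split y))
                              (cong₂ (adj G) (join-split x) (join-split y))
    }
  where
  within : ∀ x y {t} → is-just (c x) ≡ true → is-just (c y) ≡ true →
           fromMaybe A (c x) ≡ t → fromMaybe A (c y) ≡ t → x ≢ y → adj G x y ≡ inA t
  within x y qx qy refl ey =
    peels x y (is-just⇒≡ qx) (just≢opposite _ (trans (is-just⇒≡ qy) (cong just ey)))

  S : SplitGraph
  S = record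
    { graph  = induced G (λ x → is-just (c x))
    ; part   = λ (x , _) → fromMaybe A (c x)
    ; clique = λ (x , qx) (y , qy) ex ey x≢y →
                 within x y qx qy ex ey λ x≡y → x≢y (Satisfying-≡ x≡y)
    ; stable = λ (x , qx) (y , qy) ex ey → case ≟-vertex G x y of λ where
                 (yes refl) → adj-irrefl G x
                 (no x≢y)   → within x y qx qy ex ey x≢y
    }

  H : Graph
  H = induced G (λ x → is-nothing (c x))

  decide : ∀ x b → is-just (c x) ≡ b → V (S ∘ H)
  decide x true  q = inj₁ (x , q)
  decide x false q = inj₂ (x , cong not q)

  split : V G → V (S ∘ H)
  split x = decide x (is-just (c x)) refl

  join : V (S ∘ H) → V G
  join = [ proj₁ , proj₁ ]′

  join-split : ∀ x → join (split x) ≡ x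
  join-split x = join-decide (is-just (c x)) refl
    where
    join-decide : ∀ b q → join (decide x b q) ≡ x
    join-decide true  _ = refl
    join-decide false _ = refl

  split-in : ∀ x q → split x ≡ inj₁ (x , q)
  split-in x q = decide-in (is-just (c x)) refl
    where
    decide-in : ∀ b q′ → decide x b q′ ≡ inj₁ (x , q)
    decide-in true  _  = cong inj₁ (Satisfying-≡ refl)
    decide-in false q′ = contradiction (trans (sym q′) q) λ ()

  split-out : ∀ x q → split x ≡ inj₂ (x , q)
  split-out x q = decide-out (is-just (c x)) refl
    where
    decide-out : ∀ b q′ → decide x b q′ ≡ inj₂ (x , q)
    decide-out false _  = cong inj₂ (Satisfying-≡ refl)
    decide-out true  q′ = contradiction (trans (sym (cong not q′)) q) λ ()

  across : ∀ x y → is-just (c x) ≡ true → is-nothing (c y) ≡ true →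
           adj G x y ≡ inA (fromMaybe A (c x))
  across x y qx qy = peels x y (is-just⇒≡ qx) (nothing≢just (is-nothing⇒≡ qy))
    λ { refl → nothing≢just (is-nothing⇒≡ qy) (is-just⇒≡ qx) }

  adj-join : ∀ a b → adj (S ∘ H) a b ≡ adj G (join a) (join b)
  adj-join (inj₁ _)        (inj₁ _)        = refl
  adj-join (inj₁ (x , qx)) (inj₂ (y , qy)) = sym (across x y qx qy)
  adj-join (inj₂ (x , qx)) (inj₁ (y , qy)) = sym (trans (adj-sym G x y) (across y x qy qx))
  adj-join (inj₂ _)        (inj₂ _)        = refl

-- Intersection of two peelings: a vertex that they put into opposite parts is left to the inner
-- graph.
meet : Maybe Part → Maybe Part → Maybe Part
meet (just A) (just A) = just A
meet (just B) (just B) = just B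
meet _        _        = nothing

meet-just : ∀ x y {t} → meet x y ≡ just t → x ≡ just t × y ≡ just t
meet-just (just A) (just A) eq = eq , eq
meet-just (just B) (just B) eq = eq , eq

meet-idem : ∀ t → meet (just t) (just t) ≡ just t
meet-idem A = refl
meet-idem B = refl

meet-≢ : ∀ {s t} → s ≢ t → meet (just s) (just t) ≡ nothing
meet-≢ {A} {A} s≢t = contradiction refl s≢t
meet-≢ {A} {B} _   = refl
meet-≢ {B} {A} _   = refl
meet-≢ {B} {B} s≢t = contradiction refl s≢t

meet-nothingʳ : ∀ x → meet x nothing ≡ nothing
meet-nothingʳ (just A) = refl
meet-nothingʳ (just B) = refl
meet-nothingʳ nothing  = refl

-- If `v` is not in the opposite part of the meet, it avoids that part in one of the two peelings,
-- and this one prescribes its adjacency to `u`.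
peels-meet : ∀ G {c c′} → Peels G c → Peels G c′ → Peels G (λ v → meet (c v) (c′ v))
peels-meet G {c} {c′} peels peels′ {t} u v u-in v-not u≢v
  with meet-just (c u) (c′ u) u-in | c v ≟ᴹ just (opposite t)
... | eq , eq′ | no c-not = peels u v eq c-not u≢v
... | eq , eq′ | yes c-opp = peels′ u v eq′
  (λ c′-opp → v-not (trans (cong₂ meet c-opp c′-opp) (meet-idem (opposite t)))) u≢v

peels-automorphism : ∀ G {c} (π : Automorphism G) → Peels G c → Peels G (λ v → c (to π v))
peels-automorphism G π peels u v u-in v-not u≢v =
  trans (sym (_≅_.adj-bij π u v))
        (peels (to π u) (to π v) u-in v-not λ eq → u≢v (to-injective π eq))

-- If the parts of `x` were opposite, adjacency to `x` would force `y` into part `t` of `c′` and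
-- `y′` into the opposite part of `c`; the two peelings would then disagree on the pair `y`, `y′`.
peels-opposite : ∀ G {c c′} → Peels G c → Peels G c′ → ∀ {y y′} → c y ≡ nothing → c′ y′ ≡ nothing →
                 ∀ {x t} → c x ≡ just t → c′ x ≢ just (opposite t)
peels-opposite G {c} {c′} peels peels′ {y} {y′} y-out y′-out {x} {t} x-in x-in′ =
  ≢opposite t (inA-injective (trans (sym yy′) (trans (adj-sym G y y′) y′y)))
  where
  xy : adj G x y ≡ inA t
  xy = peels x y x-in (nothing≢just y-out) λ { refl → nothing≢just y-out x-in }

  xy′ : adj G x y′ ≡ inA (opposite t)
  xy′ = peels′ x y′ x-in′ (nothing≢just y′-out) λ { refl → nothing≢just y′-out x-in′ }

  y-in′ : c′ y ≡ just t
  y-in′ = decidable-stable (_ ≟ᴹ _) λ n → ≢opposite t (inA-injective (trans (sym xy)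
    (peels′ x y x-in′ (λ e → n (trans e (cong just (opposite-involutive t))))
            λ { refl → nothing≢just y-out x-in })))

  y′-in : c y′ ≡ just (opposite t)
  y′-in = decidable-stable (_ ≟ᴹ _) λ n → ≢opposite t (inA-injective (trans (sym
    (peels x y′ x-in n λ { refl → nothing≢just y′-out x-in′ })) xy′))

  y≢y′ : y ≢ y′
  y≢y′ refl = nothing≢just y-out y′-in

  yy′ : adj G y y′ ≡ inA t
  yy′ = peels′ y y′ y-in′ (nothing≢just y′-out) y≢y′

  y′y : adj G y′ y ≡ inA (opposite t)
  y′y = peels y′ y y′-in (nothing≢just y-out) λ eq → y≢y′ (sym eq)

adj-same-part : ∀ S {t} u v → part S u ≡ t → part S v ≡ t → u ≢ v → adj (graph S) u v ≡ inA t
adj-same-part S {A} u v pu pv u≢v = clique S u v pu pv u≢v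
adj-same-part S {B} u v pu pv _   = stable S u v pu pv

peels-part : ∀ S → Peels (graph S) (λ v → just (part S v))
peels-part S {t} u v u-in v-not =
  adj-same-part S u v (just-injective u-in) (≢opposite⇒≡ t λ eq → v-not (cong just eq))

outerPart : ∀ S H → V (S ∘ H) → Maybe Part
outerPart S H (inj₁ u) = just (part S u)
outerPart S H (inj₂ _) = nothing

peels-outer : ∀ S H → Peels (S ∘ H) (outerPart S H)
peels-outer S H (inj₁ u) (inj₁ v) u-in v-not u≢v =
  peels-part S u v u-in v-not λ eq → u≢v (cong inj₁ eq)
peels-outer S H (inj₁ u) (inj₂ _) u-in _ _ = cong inA (just-injective u-in)

-- Proper components and runs

-- For t = A the vertex is universal, for t = B it is isolated.
Extremal : Part → ∀ G → V G → Set
Extremal t G v = ∀ u → u ≢ v → adj G v u ≡ inA t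

Avoids : Part → Graph → Set
Avoids t G = ∀ v → ¬ Extremal t G v

record Proper (G : Graph) : Set₁ where
  field
    indecomposable : Indecomposable G
    vertex         : V G
    another        : (v : V G) → ∃ λ (u : V G) → u ≢ v

open Proper

order≢1⇒proper : ∀ G → NonEmpty G → order G ≢ 1 → Indecomposable G → Proper G
order≢1⇒proper G ne order≢1 ind with order G | enum G
... | zero        | _ = contradiction ne λ ()
... | suc zero    | _ = contradiction refl order≢1
... | suc (suc n) | e = record
  { indecomposable = ind
  ; vertex         = e.from zero
  ; another        = another′
  }
  where
  module e = Inverse e

  another′ : ∀ v → ∃ λ u → u ≢ v
  another′ v with e.to v in eq
  ... | zero  = e.from (suc zero) , λ { refl → contradiction (trans (sym (e.strictlyInverseˡ _)) eq) λ () }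
  ... | suc _ = e.from zero , λ { refl → contradiction (trans (sym (e.strictlyInverseˡ _)) eq) λ () }

-- A universal or isolated vertex could be peeled off alone, as a split graph with that vertex in
-- part `t`.
proper-avoids : ∀ {G} → Proper G → ∀ t → Avoids t G
proper-avoids {G} proper t v extremal =
  let w , w≢v = another proper v in
  indecomposable proper (peels⇒decomposable G {single} peels single-here (single-there w≢v))
  where
  single : V G → Maybe Part
  single u with ≟-vertex G u v
  ... | yes _ = just t
  ... | no  _ = nothing

  single-here : single v ≡ just t
  single-here with ≟-vertex G v v
  ... | yes _  = refl
  ... | no v≢v = contradiction refl v≢v

  single-there : ∀ {u} → u ≢ v → single u ≡ nothing
  single-there {u} u≢v with ≟-vertex G u v
  ... | yes u≡v = contradiction u≡v u≢v
  ... | no _    = refl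

  peels : Peels G single
  peels x y x-in _ x≢y with ≟-vertex G x v
  peels x y refl _ x≢y | yes refl = extremal y λ eq → x≢y (sym eq)

-- If `v` changes its part, every vertex does, as otherwise the meet of `p` and `p′` would decompose
-- `G`. Then each part holds at most one vertex, and `v` is extremal in a graph of two vertices.
proper-partRigid : ∀ S → Proper (graph S) → PartRigid S
proper-partRigid S proper σ v = decidable-stable (p′ v ≟ᴾ p v) moved⇒⊥
  where
  G = graph S
  p = part S

  p′ : V G → Part
  p′ u = p (to σ u)

  peels′ : Peels G (λ u → just (p′ u))
  peels′ = peels-automorphism G {λ u → just (p u)} σ (peels-part S)

  moved⇒⊥ : ¬ (p′ v ≢ p v)
  moved⇒⊥ v-moved = proper-avoids proper t v extremal
    where
    moved : ∀ u → p u ≢ p′ u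
    moved u eq = indecomposable proper (peels⇒decomposable G
      (peels-meet G {λ u → just (p u)} {λ u → just (p′ u)} (peels-part S) peels′)
      (trans (cong (λ q → meet (just (p u)) (just q)) (sym eq)) (meet-idem (p u)))
      (meet-≢ λ eq → v-moved (sym eq)))

    -- Distinct vertices in the same part would be sent by σ into the opposite part.
    p-injective : ∀ {u w} → p u ≡ p w → u ≡ w
    p-injective {u} {w} eq = decidable-stable (≟-vertex G u w) λ u≢w →
      moved u (inA-injective (trans
        (sym (peels-part S u w refl (just≢opposite _ (cong just (sym eq))) u≢w))
        (peels′ u w refl (just≢opposite _ (cong just p′-eq)) u≢w)))
      where
      p′-eq : p′ w ≡ p′ u
      p′-eq = ≢opposite⇒≡ (p′ u) λ w-opp → moved w (trans (sym eq)
        (trans (≢opposite⇒≡ (opposite (p′ u)) λ e → moved u (trans e (opposite-involutive _))) (sym w-opp)))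

    w = proj₁ (another proper v)
    w≢v = proj₂ (another proper v)
    -- The type for which `v` is extremal is read off from its adjacency to `w`, which turns out to
    -- be the only other vertex.
    t = proj₁ (inA-surjective (adj G v w))

    p-opp : ∀ u → u ≢ v → p u ≡ opposite (p v)
    p-opp u u≢v = ≢opposite⇒≡ (opposite (p v)) λ e →
      u≢v (p-injective (trans e (opposite-involutive (p v))))

    extremal : Extremal t G v
    extremal u u≢v = trans (cong (adj G v) (p-injective (trans (p-opp u u≢v) (sym (p-opp w w≢v)))))
                           (proj₂ (inA-surjective (adj G v w)))

-- Suppose that `π` sends `u` into `H`, and compare the peeling `c` by `S` with its pullback `c′`.
-- All of `S` lies outside `c′`; the preimage of `u`, a vertex of `H`, then forces the parts in `S`
-- to be equal, and `u` is extremal.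
proper-splits : ∀ S H → Proper (graph S) → V H → Splits S H
proper-splits S H proper h π u with to π (inj₁ u) in image
... | inj₁ u′ = u′ , refl
... | inj₂ _  = contradiction extremal (proper-avoids proper (part S u) u)
  where
  c c′ : V (S ∘ H) → Maybe Part
  c = outerPart S H
  c′ v = c (to π v)

  peels′ : Peels (S ∘ H) c′
  peels′ = peels-automorphism (S ∘ H) {c} π (peels-outer S H)

  u-out : c′ (inj₁ u) ≡ nothing
  u-out = cong c image

  peels-inner : Peels (graph S) (λ v → meet (c (inj₁ v)) (c′ (inj₁ v)))
  peels-inner x y x-in y-not x≢y =
    peels-meet (S ∘ H) {c} {c′} (peels-outer S H) peels′ (inj₁ x) (inj₁ y) x-in y-not
      λ eq → x≢y (inj₁-injective eq)

  -- If `v` were inside `c′`, its parts in both peelings would agree by `peels-opposite`, with `h`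
  -- and `u` as the vertices left out; the meet would then contain `v` but not `u`.
  out : ∀ v → c′ (inj₁ v) ≡ nothing
  out v with c′ (inj₁ v) in eq
  ... | nothing = refl
  ... | just q = contradiction
    (peels⇒decomposable (graph S) peels-inner {v} {u}
      (trans (cong (meet (just (part S v))) (trans eq (cong just agree))) (meet-idem (part S v)))
      (trans (cong (meet (just (part S u))) u-out) (meet-nothingʳ (just (part S u)))))
    (indecomposable proper)
    where
    agree : q ≡ part S v
    agree = ≢opposite⇒≡ (part S v) λ e →
      peels-opposite (S ∘ H) {c} {c′} (peels-outer S H) peels′ {inj₂ h} {inj₁ u} refl u-out {inj₁ v} refl
        (trans eq (cong just e))

  preimage : V (S ∘ H)
  preimage = from π (inj₁ u)

  preimage-in : c′ preimage ≡ just (part S u)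
  preimage-in = cong c (_≅_.strictlyInverseˡ π (inj₁ u))

  -- The preimage of u lies in H, hence is joined to S as prescribed by both peelings.
  part-constant : ∀ v → part S v ≡ part S u
  part-constant v with preimage in eq
  ... | inj₁ w = contradiction (trans (cong c′ (sym eq)) preimage-in) (nothing≢just (out w))
  ... | inj₂ w = inA-injective
    (peels′ (inj₂ w) (inj₁ v) (trans (cong c′ (sym eq)) preimage-in) (nothing≢just (out v)) λ ())

  extremal : Extremal (part S u) (graph S) u
  extremal v v≢u = adj-same-part S u v refl (part-constant v) λ eq → v≢u (sym eq)

-- An extremal vertex inside `H` would force all of `S` into part `t`, and then every vertex of `S`
-- would be extremal in `S`.
proper-∘-avoids : ∀ S H → Proper (graph S) → ∀ t → Avoids t (S ∘ H)
proper-∘-avoids S H proper t (inj₁ v) extremal =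
  proper-avoids proper t v λ u u≢v → extremal (inj₁ u) λ eq → u≢v (inj₁-injective eq)
proper-∘-avoids S H proper t (inj₂ h) extremal =
  proper-avoids proper t v λ u u≢v →
    adj-same-part S v u (part≡t v) (part≡t u) λ eq → u≢v (sym eq)
  where
  v = vertex proper

  part≡t : ∀ u → part S u ≡ t
  part≡t u = inA-injective (extremal (inj₁ u) λ ())

extremal-automorphism : ∀ {t} G (π : Automorphism G) {v} → Extremal t G v → Extremal t G (to π v)
extremal-automorphism G π {v} extremal u u≢πv =
  trans (cong (adj G (to π v)) (sym (_≅_.strictlyInverseˡ π u)))
 (trans (_≅_.adj-bij π v (from π u))
        (extremal (from π u) λ eq → u≢πv (trans (sym (_≅_.strictlyInverseˡ π u)) (cong (to π) eq))))

-- The vertices of the run are extremal in the composition, and so are their images; an image inside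
-- `H` would be extremal in `H` too.
uniform-splits : ∀ t m H → Avoids t H → Splits (uniform t m) H
uniform-splits t m H avoids π i with to π (inj₁ i) in image
... | inj₁ j = j , refl
... | inj₂ h = contradiction
  (λ u u≢h → extremal (inj₂ u) λ eq → u≢h (inj₂-injective eq)) (avoids h)
  where
  S = uniform t m

  extremal-run : Extremal t (S ∘ H) (inj₁ i)
  extremal-run (inj₁ j) j≢i = adj-same-part S i j refl refl λ eq → j≢i (cong inj₁ (sym eq))
  extremal-run (inj₂ _) _   = refl

  extremal : Extremal t (S ∘ H) (inj₂ h)
  extremal = subst (Extremal t (S ∘ H)) image (extremal-automorphism (S ∘ H) π extremal-run)

uniform-∘-avoids : ∀ {s t} m H → V H → s ≢ t → Avoids s (uniform t (suc m) ∘ H)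
uniform-∘-avoids m H h s≢t (inj₁ _) extremal =
  s≢t (sym (inA-injective (extremal (inj₂ h) λ ())))
uniform-∘-avoids m H h s≢t (inj₂ _) extremal =
  s≢t (sym (inA-injective (extremal (inj₁ zero) λ ())))

-- Two vertices are required, since a lone vertex is both universal and isolated.
uniform-avoids : ∀ {s t} m → s ≢ t → Avoids s (graph (uniform t (suc (suc m))))
uniform-avoids {s} {t} m s≢t v extremal = s≢t (inA-injective
  (trans (sym (extremal u u≢v)) (adj-same-part (uniform t _) v u refl refl λ eq → u≢v (sym eq))))
  where
  other : ∀ v → ∃ λ (u : Fin (suc (suc m))) → u ≢ v
  other zero    = suc zero , λ ()
  other (suc _) = zero , λ ()

  u = proj₁ (other v)
  u≢v = proj₂ (other v)

-- The compact decomposition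

realise : Blocks → Decomposition
realise (bs , b) = map realiseSplit bs ▹ realiseCore b

StartsWithRun : Part → Blocks → Set
StartsWithRun t (run s _ ∷ _  , _      ) = t ≡ s
StartsWithRun t (keep _  ∷ _  , _      ) = ⊥
StartsWithRun t ([]           , run s _) = t ≡ s
StartsWithRun t ([]           , keep _ ) = ⊥

-- Invariant of the construction from the inside outwards. Maximality of an outer run is recorded as
-- the absence of extremal vertices of its type in the rest; an innermost run has at least two
-- vertices.
data Reduced : Blocks → Set₁ where
  lastRun   : ∀ {t m} → Reduced ([] , run t (suc (suc m)))
  lastKeep  : ∀ {H} → Proper H → Reduced ([] , keep H)
  outerRun  : ∀ {t m bs b} → let d = realise (bs , b) in
              Tame d → V ⟦ d ⟧ → Avoids t ⟦ d ⟧ → Reduced (run t (suc m) ∷ bs , b)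
  outerKeep : ∀ {S bs b} → let d = realise (bs , b) in
              Tame d → V ⟦ d ⟧ → Proper (graph S) → Reduced (keep S ∷ bs , b)

reduced-vertex : ∀ {bb} → Reduced bb → V ⟦ realise bb ⟧
reduced-vertex lastRun                = zero
reduced-vertex (lastKeep proper)      = vertex proper
reduced-vertex (outerRun _ _ _)       = inj₁ zero
reduced-vertex (outerKeep _ _ proper) = inj₁ (vertex proper)

reduced-tame : ∀ {bb} → Reduced bb → Tame (realise bb)
reduced-tame lastRun      = tt
reduced-tame (lastKeep _) = tt
reduced-tame (outerRun {t} {m} {bs} {b} tame _ avoids) =
  uniform-splits t (suc m) ⟦ realise (bs , b) ⟧ avoids , (λ _ _ → refl) , tame
reduced-tame (outerKeep {S} {bs} {b} tame v proper) =
  proper-splits S ⟦ realise (bs , b) ⟧ proper v , proper-partRigid S proper , tame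

-- This gives a newly started run its maximality, by cases on the block just inside it.
reduced-avoids : ∀ {t bb} → Reduced bb → ¬ StartsWithRun t bb → Avoids t ⟦ realise bb ⟧
reduced-avoids (lastRun {m = m}) differs = uniform-avoids m differs
reduced-avoids {t} (lastKeep proper) _ = proper-avoids proper t
reduced-avoids (outerRun {m = m} {bs} {b} _ v _) differs =
  uniform-∘-avoids m ⟦ realise (bs , b) ⟧ v differs
reduced-avoids {t} (outerKeep {S} {bs} {b} _ _ proper) _ =
  proper-∘-avoids S ⟦ realise (bs , b) ⟧ proper t

reduced-newRun : ∀ {t bs b} → Reduced (bs , b) → ¬ StartsWithRun t (bs , b) →
                 Reduced (run t 1 ∷ bs , b)
reduced-newRun reduced differs =
  outerRun (reduced-tame reduced) (reduced-vertex reduced) (reduced-avoids reduced differs)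

reduced-addTrivial : ∀ t {bb} → Reduced bb → Reduced (addTrivial t bb)
reduced-addTrivial t {[] , run s _} reduced@lastRun with t ≟ᴾ s
... | yes refl = lastRun
... | no t≢s   = reduced-newRun reduced t≢s
reduced-addTrivial t {[] , keep _} reduced = reduced-newRun reduced id
reduced-addTrivial t {keep _ ∷ _ , _} reduced = reduced-newRun reduced id
reduced-addTrivial t {run s _ ∷ _ , _} reduced@(outerRun tame v avoids) with t ≟ᴾ s
-- A longer run surrounds the same inner graph, so the evidence carries over.
... | yes refl = outerRun tame v avoids
... | no t≢s   = reduced-newRun reduced t≢s

untyped⇒order≢1 : ∀ S → type S ≡ nothing → order (graph S) ≢ 1
untyped⇒order≢1 S eq with order (graph S) ℕ.≟ 1
untyped⇒order≢1 S () | yes _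
untyped⇒order≢1 S _  | no n = n

untyped⇒proper : ∀ S → type S ≡ nothing → NonEmpty (graph S) → Indecomposable (graph S) →
                 Proper (graph S)
untyped⇒proper S eq ne = order≢1⇒proper (graph S) ne (untyped⇒order≢1 S eq)

reduced-addComponent : ∀ S {bb} → NonEmpty (graph S) → Indecomposable (graph S) →
                       Reduced bb → Reduced (addComponent S bb)
reduced-addComponent S ne ind reduced with type S in eq
... | just t  = reduced-addTrivial t reduced
... | nothing = outerKeep (reduced-tame reduced) (reduced-vertex reduced)
                          (untyped⇒proper S eq ne ind)

-- The type of the core depends on the last outer component alone, so the induction may drop the
-- outermost one while another remains.
coreType-∷ : ∀ S S′ Ss H → coreType ((S ∷ S′ ∷ Ss) ▹ H) ≡ coreType ((S′ ∷ Ss) ▹ H)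
coreType-∷ S S′ Ss H with order H ℕ.≟ 1
... | yes _ = refl
... | no _  = refl

-- A trivial core forms a proper block only together with G₁, hence the base case of length one.
canonical⇒reduced : ∀ S Ss H → IsCanonical ((S ∷ Ss) ▹ H) → Reduced (blocks ((S ∷ Ss) ▹ H))
canonical⇒reduced S [] H canonical with order H ℕ.≟ 1
... | no order≢1 = reduced-addComponent S (proj₁ (canonical zero)) (proj₂ (canonical zero))
  (lastKeep (order≢1⇒proper H (proj₁ (canonical (suc zero))) order≢1 (proj₂ (canonical (suc zero)))))
... | yes _ with type S in eq
-- Here the core stays an untyped single vertex, which is not `Proper`; `outerKeep` asks for a tame
-- rest with a vertex in it.
...   | nothing = outerKeep tt (someVertex H (proj₁ (canonical (suc zero))))
                    (untyped⇒proper S eq (proj₁ (canonical zero)) (proj₂ (canonical zero)))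
  where
  someVertex : ∀ G → NonEmpty G → V G
  someVertex G ne with order G | enum G
  someVertex G () | zero  | _
  someVertex G _  | suc _ | e = Inverse.from e zero
-- The trivial core inherits the type of `S`, so both merge into a run of two vertices.
...   | just t with t ≟ᴾ t
...     | yes _ = lastRun
...     | no t≢t = contradiction refl t≢t
canonical⇒reduced S (S′ ∷ Ss) H canonical =
  reduced-addComponent S (proj₁ (canonical zero)) (proj₂ (canonical zero))
    (subst (λ t → Reduced (foldr addComponent ([] , coreBlock t H) (S′ ∷ Ss)))
           (sym (coreType-∷ S S′ Ss H))
           (canonical⇒reduced S′ Ss H λ i → canonical (suc i)))

compact-tame : ∀ d → IsCanonical d → Tame (compact d)
compact-tame ([] ▹ H) canonical with order H ℕ.≟ 1
... | yes _ = tt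
... | no _  = tt
compact-tame ((S ∷ Ss) ▹ H) canonical = reduced-tame (canonical⇒reduced S Ss H canonical)

-- Distinguishing numbers

≤maximum : ∀ {n} (f : Fin n → ℕ) i → f i ≤ maximum f
≤maximum f = All.tabulate⁻ {f = f} (xs≤max 0 _)

maximum≤ : ∀ {n} (f : Fin n → ℕ) {m} → (∀ i → f i ≤ m) → maximum f ≤ m
maximum≤ f bound = max≤v⁺ z≤n (All.tabulate⁺ bound)

glue : ∀ d {X : Set} → (∀ i → V (component d i) → X) → V ⟦ d ⟧ → X
glue ([]       ▹ H) f v        = f zero v
glue ((S ∷ Ss) ▹ H) f (inj₁ v) = f zero v
glue ((S ∷ Ss) ▹ H) f (inj₂ v) = glue (Ss ▹ H) (λ i → f (suc i)) v

glue-include : ∀ d {X : Set} (f : ∀ i → V (component d i) → X) i v → glue d f (include d i v) ≡ f i v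
glue-include ([]       ▹ H) f zero    v = refl
glue-include ((S ∷ Ss) ▹ H) f zero    v = refl
glue-include ((S ∷ Ss) ▹ H) f (suc i) v = glue-include (Ss ▹ H) (λ i → f (suc i)) i v

distinguishable-mono : ∀ G {c c′} → c ≤ c′ → Distinguishable G c → Distinguishable G c′
distinguishable-mono G c≤c′ (φ , dist) =
  (λ v → inject≤ (φ v) c≤c′) , λ π nonTrivial →
    let v , φ≢ = dist π nonTrivial in v , λ eq → φ≢ (Fin.inject≤-injective c≤c′ c≤c′ _ _ eq)

theorem3p4 : (G : Graph) (dec : CompactCanonicalDecomposition G) →
    let open CompactCanonicalDecomposition dec in
    (∀ {c : ℕ} (φ : Labeling G c) →
    Distinguishing G φ ⇔ (∀ i → Distinguishing (component compacted i) (restrict φ i)))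
    × D G ≡ maximum (λ i → D (component compacted i))
theorem3p4 G dec = equivalence , ℕ.≤-antisym
    -- Optimal labelings of the components, viewed with the maximum number of labels, are glued to
    -- one of `G`.
    (proj₂ (D-isLeast G) _ (combine λ i →
      distinguishable-mono (component compacted i) (≤maximum (λ i → D (component compacted i)) i)
                           (proj₁ (D-isLeast (component compacted i)))))
    -- Conversely, an optimal labeling of `G` restricts to every component.
    (maximum≤ _ λ i →
      let φ , dist = proj₁ (D-isLeast G) in
      proj₂ (D-isLeast (component compacted i)) _ (restrict φ i , Equivalence.to (equivalence φ) dist i))
  where
  open CompactCanonicalDecomposition dec

  equivalence : ∀ {c : ℕ} (φ : Labeling G c) →
    Distinguishing G φ ⇔ (∀ i → Distinguishing (component compacted i) (restrict φ i))
  equivalence φ =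
    mk⇔ (λ rigid i → Equivalence.from (distinguishing⇔rigid _ (restrict φ i)) (rigid i))
        (λ dist i → Equivalence.to (distinguishing⇔rigid _ (restrict φ i)) (dist i))
    ⇔-∘ (rigid-components (outer compacted) (core compacted) (compact-tame canonical isCanonical) _
    ⇔-∘ (rigid-≅ compact-iso φ
    ⇔-∘ distinguishing⇔rigid G φ))

  combine : ∀ {c} → (∀ i → Distinguishable (component compacted i) c) → Distinguishable G c
  combine each = φ , Equivalence.from (equivalence φ) λ i →
    Equivalence.from (distinguishing⇔rigid _ _)
      -- The glued labeling restricts to the given ones only pointwise, so rigidity has to be
      -- carried over.
      (rigid-cong (component compacted i) (λ v → sym (restricts i v))
        (Equivalence.to (distinguishing⇔rigid _ _) (proj₂ (each i))))
    where
    φ : Labeling G _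
    φ v = glue compacted (λ i → proj₁ (each i)) (to compact-iso v)

    restricts : ∀ i v → restrict φ i v ≡ proj₁ (each i) v
    restricts i v = trans (cong (glue compacted _) (_≅_.strictlyInverseˡ compact-iso _))
                          (glue-include compacted _ i v)
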